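{- Let $q$ be a prime power and let $n\geq 2$ be an integer. Let $\Psi:\mathcal{D}(n)\to\mathcal{M}_n$ be the map sending $(\delta_1,\dots,\delta_{n-1})$ to the Motzkin word $p_1\dots p_n$ where, with $\delta_0=\delta_n=0$, for every $1\leq i\leq n$, $$p_i=\begin{cases} U & \text{if } \delta_i-\delta_{i-1}=1,\\ H & \text{if } \delta_i-\delta_{i-1}=0,\\ D & \text{if } \delta_i-\delta_{i-1}=-1.\end{cases}$$ Then for every distance vector $v=(\delta_1,\dots,\delta_{n-1})\in\mathcal{D}(n)$ we have $A(\Psi(v))=\delta_1+\cdots+\delta_{n-1}$. In other words, $\Psi$ takes flag distance to area, and for every integer $d\in[0,\lfloor n^2/4\rfloor]$ the restriction $\Psi|_{\mathcal{D}(d,n)}:\mathcal{D}(d,n)\to\mathcal{M}_n(d)$ is a bijection.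
   Context: Let $\mathbb{F}_q$ be the finite field with $q$ elements. A full flag on $\mathbb{F}_q^n$ is a sequence $\mathcal{F}=(\mathcal{F}_1,\dots,\mathcal{F}_{n-1})$ of $\mathbb{F}_q$-subspaces of $\mathbb{F}_q^n$ with $\mathcal{F}_1\subsetneq\cdots\subsetneq\mathcal{F}_{n-1}$ and $\dim \mathcal{F}_i=i$ for every $i$; the set of all full flags is the full flag variety $\mathcal{F}_q(n)$. For subspaces $\mathcal{U},\mathcal{V}$ of the same dimension $k$, the injection distance is $d_I(\mathcal{U},\mathcal{V})=k-\dim(\mathcal{U}\cap\mathcal{V})$. The distance vector of $\mathcal{F},\mathcal{F}'\in\mathcal{F}_q(n)$ is $\mathbf{d}(\mathcal{F},\mathcal{F}')=(d_I(\mathcal{F}_1,\mathcal{F}'_1),\dots,d_I(\mathcal{F}_{n-1},\mathcal{F}'_{n-1}))\in\mathbb{Z}^{n-1}$; the flag distance $d_f(\mathcal{F},\mathcal{F}')=\sum_{i=1}^{n-1} d_I(\mathcal{F}_i,\mathcal{F}'_i)$ is the sum of its components. Put $\mathcal{D}(n)=\{\mathbf{d}(\mathcal{F},\mathcal{F}') \mid \mathcal{F},\mathcal{F}'\in\mathcal{F}_q(n)\}$ and $\mathcal{D}(d,n)=\{\mathbf{d}(\mathcal{F},\mathcal{F}') \mid \mathcal{F},\mathcal{F}'\in\mathcal{F}_q(n),\ d_f(\mathcal{F},\mathcal{F}')=d\}$ (pairs with $\mathcal{F}=\mathcal{F}'$ are allowed). A Motzkin path of length $n$ is a lattice path in $\mathbb{Z}^2$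 from $(0,0)$ to $(n,0)$ with steps $U=(1,1)$, $D=(1,-1)$, $H=(1,0)$ that never runs below the $x$-axis; $\mathcal{M}_n$ is the set of these, and a path is identified with its Motzkin word $p_1\dots p_n$ in the letters $U,D,H$. The area $A(p)$ of a Motzkin path $p$ is the area of the region above the $x$-axis and below $p$, and $\mathcal{M}_n(d)$ is the set of Motzkin paths of length $n$ and area $d$. (The map $\Psi$ is well defined: consecutive components of a distance vector, including $\delta_0=\delta_n=0$, differ by $-1$, $0$ or $1$, and the resulting word is a Motzkin word.) -}

module Defs where

open import Algebra.Apartness.Bundles using (HeytingField; HeytingCommutativeRing)
open import Algebra.Bundles using (CommutativeRing)
import Algebra.Properties.CommutativeMonoid.Sum as CommutativeMonoidSum
import Algebra.Properties.Ring as RingProperties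
import Algebra.Properties.Semiring.Sum as SemiringSum
open import Data.Fin.Base as Fin using (Fin; zero; suc; toℕ; fromℕ; fromℕ<; inject₁)
open import Data.Fin.Properties as Fin using (all?; any?)
open import Data.Integer.Base as ℤ using (ℤ; +_; 0ℤ; 1ℤ; -1ℤ)
open import Data.List.Base using (List; []; _∷_; cartesianProductWith; allFin)
import Data.List.Base as List
import Data.List.Membership.Setoid.Properties as Membership
open import Data.List.Membership.Propositional.Properties using (∈-allFin)
open import Data.List.Relation.Unary.Any as Any using (Any; here; there)
open import Data.Nat.Base as ℕ using (ℕ; zero; suc; _∸_; _^_)
open import Data.Nat.Primality using (Prime)
import Data.Nat.Properties as ℕ
open import Data.Product.Base using (Σ-syntax; ∃; ∃₂; _×_; _,_; proj₁; proj₂)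
open import Data.Rational.Base as ℚ using (ℚ; _/_)
import Data.Rational.Properties as ℚ
open import Data.Vec.Base as Vec using (Vec; []; _∷_; lookup; tabulate; foldr′)
open import Data.Vec.Functional as Vector using (Vector)
import Data.Vec.Functional.Relation.Binary.Equality.Setoid as VectorEquality
open import Function.Base using (_on_; _∘_)
open import Function.Bundles using (Inverse)
open import Level using (_⊔_) renaming (suc to lsuc)
open import Relation.Binary.Core using (Rel)
open import Relation.Binary.Definitions using (Decidable)
open import Relation.Binary.PropositionalEquality as ≡ using (_≡_)
import Relation.Binary.Reasoning.Setoid as SetoidReasoning
open import Relation.Nullary.Decidable using (Dec; yes; no; map′; _×-dec_)
open import Relation.Nullary.Negation using (¬_; contradiction)
open import Relation.Unary using (Pred; _⊂_)
import Relation.Unary as Unary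

IsPrimePower : ℕ → Set
IsPrimePower q = ∃₂ λ p k → Prime p × 1 ℕ.≤ k × q ≡ p ^ k

record FiniteField c ℓ₁ ℓ₂ (q : ℕ) : Set (lsuc (c ⊔ ℓ₁ ⊔ ℓ₂)) where
  field
    heytingField : HeytingField c ℓ₁ ℓ₂

  open HeytingField heytingField public
    using (heytingCommutativeRing; #⇒invertible; invertible⇒#; tight)
  open HeytingCommutativeRing heytingCommutativeRing public
    using (commutativeRing)
  open CommutativeRing commutativeRing public

  field
    enumeration : Inverse setoid (≡.setoid (Fin q))

module _ {c ℓ₁ ℓ₂ q} (𝔽 : FiniteField c ℓ₁ ℓ₂ q) where

  open FiniteField 𝔽 hiding (zero)
  open SemiringSum semiring using (sum; sum-cong-≋; *-distribˡ-sum; sum-replicate-zero)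
  open VectorEquality setoid using (_≋_; ≋-trans; ≋-setoid)

  lincomb : ∀ {k n} → Vector Carrier k → Vector (Vector Carrier n) k → Vector Carrier n
  lincomb a b j = sum (λ i → a i * b i j)

  Independent : ∀ {k n} → Vector (Vector Carrier n) k → Set (c ⊔ ℓ₁)
  Independent b = ∀ a → lincomb a b ≋ (λ _ → 0#) → a ≋ (λ _ → 0#)

  _∈Span_ : ∀ {k n} → Vector Carrier n → Vector (Vector Carrier n) k → Set (c ⊔ ℓ₁)
  v ∈Span b = ∃ λ a → v ≋ lincomb a b

  -- 𝔽ⁿ is finite, so its subsets in the classical sense are its decidable
  -- predicates.
  record Subspace (n : ℕ) : Set (lsuc (c ⊔ ℓ₁)) where
    field
      Member  : Pred (Vector Carrier n) (c ⊔ ℓ₁)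
      member? : Unary.Decidable Member
      resp-≋  : ∀ {u v} → u ≋ v → Member u → Member v
      0-mem   : Member (λ _ → 0#)
      +-mem   : ∀ {u v} → Member u → Member v → Member (λ j → u j + v j)
      *-mem   : ∀ x {v} → Member v → Member (λ j → x * v j)

  open Subspace

  _∩_ : ∀ {n} → Subspace n → Subspace n → Subspace n
  U ∩ V = record
    { Member  = λ v → Member U v × Member V v
    ; member? = λ v → member? U v ×-dec member? V v
    ; resp-≋  = λ u≋v (u∈U , u∈V) → resp-≋ U u≋v u∈U , resp-≋ V u≋v u∈V
    ; 0-mem   = 0-mem U , 0-mem V
    ; +-mem   = λ (u∈U , u∈V) (v∈U , v∈V) → +-mem U u∈U v∈U , +-mem V u∈V v∈V
    ; *-mem   = λ x (v∈U , v∈V) → *-mem U x v∈U , *-mem V x v∈V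
    }

  record Basis {n} (U : Subspace n) (k : ℕ) : Set (c ⊔ ℓ₁) where
    field
      vectors     : Vector (Vector Carrier n) k
      contained   : ∀ i → Member U (vectors i)
      independent : Independent vectors
      spanning    : ∀ v → Member U v → v ∈Span vectors

  module BasisConstruction where
    open RingProperties ring using (-‿distribˡ-*; -‿distribʳ-*; -0#≈0#)
    open SetoidReasoning setoid
    module Enum = Inverse enumeration

    _≟_ : Decidable _≈_
    x ≟ y = map′
      (λ eq → trans (sym (Enum.strictlyInverseʳ x))
                    (trans (Enum.from-cong eq) (Enum.strictlyInverseʳ y)))
      Enum.to-cong
      (Enum.to x Fin.≟ Enum.to y)

    nonzero⇒inverse : ∀ x → ¬ (x ≈ 0#) → ∃ λ y → y * x ≈ 1#
    nonzero⇒inverse x x≉0 with any? (λ i → (Enum.from i * x) ≟ 1#)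
    ... | yes (i , eq) = Enum.from i , eq
    ... | no ∄inverse = contradiction (proj₁ (tight x 0#) x¬#0) x≉0
      where
      x-0≈x : x - 0# ≈ x
      x-0≈x = trans (+-congˡ -0#≈0#) (+-identityʳ x)
      x¬#0 : ¬ (HeytingField._#_ heytingField x 0#)
      x¬#0 x#0 with y , y*x≈1 , _ ← #⇒invertible x#0 =
        ∄inverse (Enum.to y , trans
          (*-cong (Enum.strictlyInverseʳ y) (sym x-0≈x)) y*x≈1)

    elements : List Carrier
    elements = List.map Enum.from (allFin q)

    elements-complete : ∀ x → Any (x ≈_) elements
    elements-complete x = Membership.∈-resp-≈ setoid (Enum.strictlyInverseʳ x)
      (Membership.∈-map⁺ (≡.setoid _) setoid Enum.from-cong (∈-allFin (Enum.to x)))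

    allVectors : ∀ n → List (Vector Carrier n)
    allVectors zero    = (λ ()) ∷ []
    allVectors (suc n) = cartesianProductWith Vector._∷_ elements (allVectors n)

    ∷-cong : ∀ {n x y} {u v : Vector Carrier n} → x ≈ y → u ≋ v → (x Vector.∷ u) ≋ (y Vector.∷ v)
    ∷-cong x≈y u≋v zero    = x≈y
    ∷-cong x≈y u≋v (suc i) = u≋v i

    allVectors-complete : ∀ n v → Any (v ≋_) (allVectors n)
    allVectors-complete zero    v = here λ ()
    allVectors-complete (suc n) v =
      Membership.∈-resp-≈ (≋-setoid (suc n)) (λ { zero → refl ; (suc i) → refl })
        (Membership.∈-cartesianProductWith⁺ setoid (≋-setoid n) (≋-setoid (suc n)) ∷-cong
          (elements-complete (Vector.head v)) (allVectors-complete n (Vector.tail v)))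

    lincomb-congˡ : ∀ {k n a a′} (b : Vector (Vector Carrier n) k) →
                    a ≋ a′ → lincomb a b ≋ lincomb a′ b
    lincomb-congˡ b a≋a′ j = sum-cong-≋ (λ i → *-congʳ (a≋a′ i))

    _∈Span?_ : ∀ {k n} (v : Vector Carrier n) (b : Vector (Vector Carrier n) k) → Dec (v ∈Span b)
    _∈Span?_ {k} v b = map′
      Any.satisfied
      (λ (a , v≋ab) → Any.map (λ a≋a′ → ≋-trans v≋ab (lincomb-congˡ b a≋a′))
                              (allVectors-complete k a))
      (Any.any? (λ a → all? (λ j → v j ≟ lincomb a b j)) (allVectors k))

    ∈Span-∷ : ∀ {k n} {v : Vector Carrier n} w {b : Vector (Vector Carrier n) k} →
              v ∈Span b → v ∈Span (w Vector.∷ b)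
    ∈Span-∷ w (a , v≋ab) = 0# Vector.∷ a , λ j →
      trans (v≋ab j) (sym (trans (+-congʳ (zeroˡ _)) (+-identityˡ _)))

    head-∈Span : ∀ {k n} (w : Vector Carrier n) (b : Vector (Vector Carrier n) k) →
                 w ∈Span (w Vector.∷ b)
    head-∈Span {k} w b = 1# Vector.∷ (λ _ → 0#) , λ j → sym (begin
      1# * w j + sum (λ i → 0# * b i j)    ≈⟨ +-cong (*-identityˡ _) (sum-cong-≋ (λ i → zeroˡ (b i j))) ⟩
      w j + sum {k} (λ _ → 0#)             ≈⟨ +-congˡ (sum-replicate-zero k) ⟩
      w j + 0#                             ≈⟨ +-identityʳ _ ⟩
      w j                                  ∎)

    ∷-independent : ∀ {k n} (w : Vector Carrier n) (b : Vector (Vector Carrier n) k) →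
                    ¬ (w ∈Span b) → Independent b → Independent (w Vector.∷ b)
    ∷-independent w b w∉b indep a ab≋0 with Vector.head a ≟ 0#
    ... | yes a₀≈0 = λ
      { zero    → a₀≈0
      ; (suc i) → indep (Vector.tail a) (λ j → begin
          lincomb (Vector.tail a) b j               ≈⟨ +-identityˡ _ ⟨
          0# + lincomb (Vector.tail a) b j          ≈⟨ +-congʳ (trans (*-congʳ a₀≈0) (zeroˡ (w j))) ⟨
          lincomb a (w Vector.∷ b) j                ≈⟨ ab≋0 j ⟩
          0#                                        ∎) i
      }
    ... | no a₀≉0 with y , ya₀≈1 ← nonzero⇒inverse _ a₀≉0 =
      contradiction ((λ i → - y * a (suc i)) , λ j → begin
          w j                                       ≈⟨ *-identityˡ _ ⟨
          1# * w j                                  ≈⟨ *-congʳ ya₀≈1 ⟨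
          y * a zero * w j                          ≈⟨ *-assoc _ _ _ ⟩
          y * (a zero * w j)                        ≈⟨ *-congˡ (solve-head j) ⟩
          y * - lincomb (Vector.tail a) b j         ≈⟨ move y _ ⟩
          - y * lincomb (Vector.tail a) b j         ≈⟨ *-distribˡ-sum (- y) (λ i → a (suc i) * b i j) ⟩
          sum (λ i → - y * (a (suc i) * b i j))     ≈⟨ sum-cong-≋ (λ i → *-assoc (- y) (a (suc i)) (b i j)) ⟨
          lincomb (λ i → - y * a (suc i)) b j       ∎) w∉b
      where
      open import Algebra.Properties.AbelianGroup +-abelianGroup using (inverseˡ-unique)
      solve-head : ∀ j → a zero * w j ≈ - lincomb (Vector.tail a) b j
      solve-head j = inverseˡ-unique _ _ (ab≋0 j)
      move : ∀ x z → x * - z ≈ - x * z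
      move x z = trans (sym (-‿distribʳ-* x z)) (-‿distribˡ-* x z)

    record PartialBasis {n} (U : Subspace n) (vs : List (Vector Carrier n)) : Set (c ⊔ ℓ₁) where
      field
        {size}      : ℕ
        vectors     : Vector (Vector Carrier n) size
        contained   : ∀ i → Member U (vectors i)
        independent : Independent vectors
        spanning    : ∀ {v} → Any (v ≋_) vs → Member U v → v ∈Span vectors

    partialBasis : ∀ {n} (U : Subspace n) vs → PartialBasis U vs
    partialBasis U [] = record
      { size        = 0
      ; vectors     = λ ()
      ; contained   = λ ()
      ; independent = λ _ _ ()
      ; spanning    = λ ()
      }
    partialBasis U (w ∷ vs) with partialBasis U vs
    ... | B with w ∈Span? PartialBasis.vectors B | member? U w
    ... | yes (a , w≋ab) | _ = record
      { PartialBasis B hiding (spanning)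
      ; spanning = λ { (here v≋w) _ → a , ≋-trans v≋w w≋ab
                     ; (there v∈vs) → PartialBasis.spanning B v∈vs }
      }
    ... | no _ | no w∉U = record
      { PartialBasis B hiding (spanning)
      ; spanning = λ { (here v≋w) v∈U → contradiction (resp-≋ U v≋w v∈U) w∉U
                     ; (there v∈vs) → PartialBasis.spanning B v∈vs }
      }
    ... | no w∉B | yes w∈U = record
      { vectors     = w Vector.∷ PartialBasis.vectors B
      ; contained   = λ { zero → w∈U ; (suc i) → PartialBasis.contained B i }
      ; independent = ∷-independent w _ w∉B (PartialBasis.independent B)
      ; spanning    = λ
          { (here v≋w) _ → let a , w≋a = head-∈Span w (PartialBasis.vectors B) in
                           a , ≋-trans v≋w w≋a
          ; (there v∈vs) v∈U → ∈Span-∷ w (PartialBasis.spanning B v∈vs v∈U) }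
      }

  open BasisConstruction using (PartialBasis; partialBasis; allVectors; allVectors-complete)

  -- Opaque: dim is the size of some basis, not of this greedily chosen one.
  abstract
    basis : ∀ {n} (U : Subspace n) → ∃ (Basis U)
    basis {n} U = PartialBasis.size B , record
      { PartialBasis B hiding (spanning)
      ; spanning = λ v → PartialBasis.spanning B (allVectors-complete n v)
      }
      where
      B : PartialBasis U (allVectors n)
      B = partialBasis U (allVectors n)

  dim : ∀ {n} → Subspace n → ℕ
  dim U = proj₁ (basis U)

  -- The 0-based index i stands for the subspace of dimension i + 1.
  record Flag (n : ℕ) : Set (lsuc (c ⊔ ℓ₁)) where
    field
      space  : Fin (n ∸ 1) → Subspace n
      nested : ∀ {i j} → i Fin.< j → Member (space i) ⊂ Member (space j)
      dims   : ∀ i → dim (space i) ≡ suc (toℕ i)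

  open Flag

  -- Only meant for subspaces U and V of the same dimension.
  injectionDistance : ∀ {n} → Subspace n → Subspace n → ℤ
  injectionDistance U V = + dim U ℤ.- + dim (U ∩ V)

  distanceVector : ∀ {n} → Flag n → Flag n → Vec ℤ (n ∸ 1)
  distanceVector F F′ = tabulate λ i → injectionDistance (space F i) (space F′ i)

sumℤ : ∀ {m} → Vec ℤ m → ℤ
sumℤ = foldr′ ℤ._+_ 0ℤ

module _ {c ℓ₁ ℓ₂ q} (𝔽 : FiniteField c ℓ₁ ℓ₂ q) where

  flagDistance : ∀ {n} → Flag 𝔽 n → Flag 𝔽 n → ℤ
  flagDistance F F′ = sumℤ (distanceVector 𝔽 F F′)

  𝒟 : ℕ → Set (lsuc (c ⊔ ℓ₁))
  𝒟 n = Σ[ δ ∈ Vec ℤ (n ∸ 1) ] ∃₂ λ F F′ → distanceVector 𝔽 {n} F F′ ≡ δ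

  𝒟[_,_] : ℕ → ℕ → Set (lsuc (c ⊔ ℓ₁))
  𝒟[ d , n ] = Σ[ δ ∈ Vec ℤ (n ∸ 1) ]
    ∃₂ λ F F′ → distanceVector 𝔽 {n} F F′ ≡ δ × flagDistance F F′ ≡ + d

data Step : Set where
  U D H : Step

rise : Step → ℤ
rise U = 1ℤ
rise D = -1ℤ
rise H = 0ℤ

-- The path of w visits the points (i , height w i).
height : ∀ {n} → Vec Step n → Fin (suc n) → ℤ
height w       zero    = 0ℤ
height (s ∷ w) (suc i) = rise s ℤ.+ height w i

record Motzkin (n : ℕ) : Set where
  field
    word    : Vec Step n
    nonneg  : ∀ i → 0ℤ ℤ.≤ height word i
    returns : height word (fromℕ n) ≡ 0ℤ

open Motzkin

-- Between consecutive lattice points the region is a trapezoid of width 1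
-- whose parallel sides are the two heights.
area : ∀ {n} → Motzkin n → ℚ
area p = sum λ i → (height (word p) (inject₁ i) ℤ.+ height (word p) (suc i)) / 2
  where open CommutativeMonoidSum ℚ.+-0-commutativeMonoid using (sum)

𝓜[_,_] : ℕ → ℕ → Set
𝓜[ d , n ] = Σ[ p ∈ Motzkin n ] area p ≡ + d / 1

-- δᵢ, with the convention that δ₀ and δₙ are 0.
component : ∀ {m} → Vec ℤ m → ℕ → ℤ
component         δ zero    = 0ℤ
component {m = m} δ (suc i) with i ℕ.<? m
... | yes i<m = lookup δ (fromℕ< i<m)
... | no  _   = 0ℤ

data StepOf : ℤ → Step → Set where
  up   : StepOf 1ℤ  U
  flat : StepOf 0ℤ  H
  down : StepOf -1ℤ D

module _ {c ℓ₁ ℓ₂ q} (𝔽 : FiniteField c ℓ₁ ℓ₂ q) {n : ℕ} where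

  -- The predicate determines the word of Ψ v, and it includes the claim that
  -- consecutive components of v differ by -1, 0 or 1.
  IsΨ : (𝒟 𝔽 n → Motzkin n) → Set (lsuc (c ⊔ ℓ₁))
  IsΨ Ψ = (v : 𝒟 𝔽 n) (i : Fin n) → let δ = proj₁ v in
    StepOf (component δ (suc (toℕ i)) ℤ.- component δ (toℕ i)) (lookup (word (Ψ v)) i)

  AreaIsSum : (𝒟 𝔽 n → Motzkin n) → Set (lsuc (c ⊔ ℓ₁))
  AreaIsSum Ψ = (v : 𝒟 𝔽 n) → area (Ψ v) ≡ sumℤ (proj₁ v) / 1

  restrict : (Ψ : 𝒟 𝔽 n → Motzkin n) → AreaIsSum Ψ →
             ∀ d → 𝒟[_,_] 𝔽 d n → 𝓜[ d , n ]
  restrict Ψ areaIsSum d (δ , F , F′ , eq , dist) =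
    Ψ v , ≡.trans (areaIsSum v)
                  (≡.cong (_/ 1) (≡.trans (≡.cong sumℤ (≡.sym eq)) dist))
    where
    v : 𝒟 𝔽 n
    v = δ , F , F′ , eq

  -- Elements of 𝒟[ d , n ] and 𝓜[ d , n ] carry proofs, so they are compared
  -- by the distance vectors and the Motzkin words alone.
  _≈𝒟_ : ∀ {d} → Rel (𝒟[_,_] 𝔽 d n) _
  _≈𝒟_ = _≡_ on proj₁

_≈𝓜_ : ∀ {d n} → Rel 𝓜[ d , n ] _
_≈𝓜_ = _≡_ on (word ∘ proj₁)

{-# OPTIONS --safe #-}
-- Complete two flags by the subspaces of dimension 0 and n. The dimension of
-- the i-th intersection grows by 0, 1 or 2 with i, so the components of a
-- distance vector are the heights of a Motzkin path, and by the trapezoid rule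
-- their sum is its area. The dimension theory needed rests on counting: k
-- independent vectors in the span of m vectors yield an injection 𝔽ᵏ → 𝔽ᵐ, so
-- qᵏ ≤ qᵐ.
--
-- Conversely, a Motzkin path is realized by two flags of coordinate subspaces,
-- built simultaneously: U adds an unused coordinate to each of them (two
-- different ones), H adds the same unused coordinate to both, and D adds to
-- each flag a coordinate that only the other one has.
module Submission where

open import Defs
import Algebra.Properties.CommutativeMonoid.Sum as CommutativeMonoidSum
import Algebra.Properties.Group as GroupProperties
import Algebra.Properties.Semiring.Sum as SemiringSum
open import Data.Fin.Base as Fin using (Fin; zero; suc; toℕ; fromℕ; fromℕ<; inject₁; finToFun; funToFin)
open import Data.Fin.Induction using (<-weakInduction)
import Data.Fin.Properties as Fin
open import Data.Fin.Subset as Subset using (Subset; inside; outside; _∉_; ∣_∣)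
open import Data.Fin.Subset.Properties as Subset using (_∈?_)
open import Data.Integer.Base as ℤ using (ℤ; +_; -[1+_]; 0ℤ; 1ℤ; +≤+)
import Data.Integer.Properties as ℤ
import Data.Integer.Tactic.RingSolver as ℤ-Solver
import Data.List.Relation.Unary.Any as Any
open import Data.Nat.Base as ℕ using (ℕ; zero; suc; z≤n; s≤s)
open import Data.Nat.Primality using (prime⇒nonTrivial)
import Data.Nat.Properties as ℕ
open import Data.Product.Base using (Σ-syntax; ∃; ∃₂; _×_; _,_; proj₁; proj₂)
open import Data.Rational.Base as ℚ using (toℚᵘ)
import Data.Rational.Properties as ℚ
open import Data.Rational.Unnormalised.Base as ℚᵘ using (mkℚᵘ; *≡*)
import Data.Rational.Unnormalised.Properties as ℚᵘ
open import Data.Vec.Base using (Vec; []; _∷_; here; there; lookup; tabulate)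
open import Data.Vec.Functional as Vector using (Vector)
import Data.Vec.Functional.Relation.Binary.Equality.Setoid as VectorEquality
import Data.Vec.Properties as Vec
open import Function.Base using (_∘_)
import Relation.Binary.Construct.On as On
open import Function.Structures using (IsBijection)
open import Level using (Lift; lift; lower)
open import Relation.Binary.PropositionalEquality as ≡ using (_≡_)
import Relation.Binary.Reasoning.Setoid as SetoidReasoning
open import Relation.Nullary.Decidable using (yes; no; map′; ¬?; _×-dec_; _→-dec_; decidable-stable)
open import Relation.Nullary.Negation using (¬_; contradiction)

-- Dimension over a finite field

module LinearAlgebra {c ℓ₁ ℓ₂ q} (1<q : 1 ℕ.< q) (𝔽 : FiniteField c ℓ₁ ℓ₂ q) where

  open FiniteField 𝔽 hiding (zero)
  open BasisConstruction 𝔽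
  open SemiringSum semiring using (sum; sum-cong-≋; sum-replicate-zero; ∑-distrib-+)
  open VectorEquality setoid using (_≋_; ≋-sym; ≋-trans)
  open GroupProperties +-group using (identityˡ-unique; x∙y⁻¹≈ε⇒x≈y)
  open Subspace
  open Basis

  private
    variable
      k m n : ℕ
      A A′ B B′ : Subspace 𝔽 n

  _⊆_ : Subspace 𝔽 n → Subspace 𝔽 n → Set _
  A ⊆ B = ∀ {v} → Member A v → Member B v

  -- Counting: 𝔽ᵏ has qᵏ elements.
  vector-injection⇒≤ : (f : Vector Carrier k → Vector Carrier m) →
                       (∀ {a a′} → f a ≋ f a′ → a ≋ a′) → k ℕ.≤ m
  vector-injection⇒≤ {k} {m} f f-injective = ℕ.≮⇒≥ λ m<k →
    ℕ.<⇒≱ (ℕ.^-monoʳ-< q 1<q m<k) (Fin.injective⇒≤ {f = code} code-injective)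
    where
    decode : Fin (q ℕ.^ k) → Vector Carrier k
    decode x i = Enum.from (finToFun x i)

    code : Fin (q ℕ.^ k) → Fin (q ℕ.^ m)
    code x = funToFin (Enum.to ∘ f (decode x))

    to-injective : ∀ {x y} → Enum.to x ≡ Enum.to y → x ≈ y
    to-injective eq = trans (sym (Enum.strictlyInverseʳ _))
                            (trans (Enum.from-cong eq) (Enum.strictlyInverseʳ _))

    from-injective : ∀ {i j} → Enum.from i ≈ Enum.from j → i ≡ j
    from-injective eq = ≡.trans (≡.sym (Enum.strictlyInverseˡ _))
                                (≡.trans (Enum.to-cong eq) (Enum.strictlyInverseˡ _))

    funToFin-injective : ∀ {r s} {g h : Fin r → Fin s} → funToFin g ≡ funToFin h → ∀ i → g i ≡ h i
    funToFin-injective {g = g} {h} eq i = ≡.trans (≡.sym (Fin.finToFun-funToFin g i))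
      (≡.trans (≡.cong (λ x → finToFun x i) eq) (Fin.finToFun-funToFin h i))

    funToFin-cong : ∀ {r s} {g h : Fin r → Fin s} → (∀ i → g i ≡ h i) → funToFin g ≡ funToFin h
    funToFin-cong {zero}  eq = ≡.refl
    funToFin-cong {suc r} eq =
      ≡.cong₂ Fin.combine (eq zero) (funToFin-cong (eq ∘ suc))

    code-injective : ∀ {x y} → code x ≡ code y → x ≡ y
    code-injective {x} {y} eq = ≡.trans (≡.sym (Fin.funToFin-finToFin {k} x)) (≡.trans
      (funToFin-cong (λ i → from-injective
        (f-injective (λ j → to-injective (funToFin-injective eq j)) i)))
      (Fin.funToFin-finToFin {k} y))


  independent⇒lincomb-injective : {b : Vector (Vector Carrier n) k} → Independent 𝔽 b →
                          ∀ {a a′} → lincomb 𝔽 a b ≋ lincomb 𝔽 a′ b → a ≋ a′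
  independent⇒lincomb-injective {b = b} indep {a} {a′} eq i = x∙y⁻¹≈ε⇒x≈y _ _
    -- The combination with coefficients `a - a′` vanishes because adding it to the one with
    -- coefficients `a′` does not change the latter.
    (indep (λ i → a i - a′ i) (λ j → identityˡ-unique _ (lincomb 𝔽 a′ b j) (begin
      lincomb 𝔽 (λ i → a i - a′ i) b j + lincomb 𝔽 a′ b j
        ≈⟨ ∑-distrib-+ (λ i → (a i - a′ i) * b i j) (λ i → a′ i * b i j) ⟨
      sum (λ i → (a i - a′ i) * b i j + a′ i * b i j)
        ≈⟨ sum-cong-≋ (λ i → trans (sym (distribʳ _ _ _)) (*-congʳ (cancel (a i) (a′ i)))) ⟩
      lincomb 𝔽 a b j
        ≈⟨ eq j ⟩
      lincomb 𝔽 a′ b j ∎)) i)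
    where
    open SetoidReasoning setoid
    cancel : ∀ x y → x - y + y ≈ x
    cancel x y = trans (+-assoc _ _ _) (trans (+-congˡ (-‿inverseˡ y)) (+-identityʳ x))

  lincomb-mem : (V : Subspace 𝔽 n) (b : Vector (Vector Carrier n) k) → (∀ i → Member V (b i)) →
                ∀ a → Member V (lincomb 𝔽 a b)
  lincomb-mem {k = zero}  V b b⊆V a = 0-mem V
  lincomb-mem {k = suc k} V b b⊆V a =
    +-mem V (*-mem V (a zero) (b⊆V zero)) (lincomb-mem V (Vector.tail b) (b⊆V ∘ suc) (Vector.tail a))

  -- The injection sends `a` to the coefficients of `lincomb 𝔽 a b` in terms of `b′`. Equal
  -- coefficients give equal combinations, and then independence of `b` gives equal `a`.
  independent-span⇒≤ : {b : Vector (Vector Carrier n) k} {b′ : Vector (Vector Carrier n) m} →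
                       Independent 𝔽 b → (∀ a → _∈Span_ 𝔽 (lincomb 𝔽 a b) b′) → k ℕ.≤ m
  independent-span⇒≤ indep span = vector-injection⇒≤ (proj₁ ∘ span) λ {a} {a′} eq →
    independent⇒lincomb-injective indep (≋-trans (proj₂ (span a))
      (≋-trans (lincomb-congˡ _ eq) (≋-sym (proj₂ (span a′)))))

  basisOf : (V : Subspace 𝔽 n) → Basis 𝔽 V (dim 𝔽 V)
  basisOf V = proj₂ (basis 𝔽 V)

  independent⇒≤dim : (V : Subspace 𝔽 n) {b : Vector (Vector Carrier n) k} →
                     Independent 𝔽 b → (∀ i → Member V (b i)) → k ℕ.≤ dim 𝔽 V
  independent⇒≤dim V {b} indep b⊆V =
    independent-span⇒≤ indep (λ a → spanning (basisOf V) _ (lincomb-mem V b b⊆V a))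

  dim-spanned : {b′ : Vector (Vector Carrier n) m} → (∀ v → Member B v → _∈Span_ 𝔽 v b′) →
                dim 𝔽 B ℕ.≤ m
  dim-spanned {B = B} span = independent-span⇒≤ (independent (basisOf B))
    (λ a → span _ (lincomb-mem B _ (contained (basisOf B)) a))

  -- As `basis` is opaque, the dimension of a concrete subspace is found by comparing the hidden
  -- basis with an explicit one in both directions.
  dim-unique : Basis 𝔽 B k → dim 𝔽 B ≡ k
  dim-unique {B = B} basisB = ℕ.≤-antisym
    (dim-spanned {B = B} (spanning basisB))
    (independent⇒≤dim B (independent basisB) (contained basisB))

  dim-mono : A ⊆ B → dim 𝔽 A ℕ.≤ dim 𝔽 B
  dim-mono {A = A} {B} A⊆B =
    independent⇒≤dim B (independent (basisOf A)) (λ i → A⊆B (contained (basisOf A) i))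

  -- For `A ⊆ B` this bounds the dimension of the quotient of `B` by `A`: every `u` in `B` outside
  -- `A` spans `B` modulo `A`. Stated for vectors, without bases, the condition passes to
  -- intersections directly.
  Codim≤1 : Subspace 𝔽 n → Subspace 𝔽 n → Set _
  Codim≤1 A B = ∀ {u v} → Member B u → ¬ Member A u → Member B v →
                ∃ λ x → Member A (λ j → v j + x * u j)

  span⊆ : (A : Subspace 𝔽 n) {v : Vector Carrier n} → _∈Span_ 𝔽 v (vectors (basisOf A)) → Member A v
  span⊆ A (a , v≋) = resp-≋ A (≋-sym v≋) (lincomb-mem A _ (contained (basisOf A)) a)

  private
    recover : ∀ v x u → (- x) * u + (v + x * u) ≈ v
    recover v x u = begin
      (- x) * u + (v + x * u)   ≈⟨ +-comm _ _ ⟩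
      v + x * u + (- x) * u     ≈⟨ +-assoc _ _ _ ⟩
      v + (x * u + (- x) * u)   ≈⟨ +-congˡ (distribʳ u x (- x)) ⟨
      v + (x - x) * u           ≈⟨ +-congˡ (trans (*-congʳ (-‿inverseʳ x)) (zeroˡ u)) ⟩
      v + 0#                    ≈⟨ +-identityʳ v ⟩
      v                         ∎
      where open SetoidReasoning setoid

  -- If some `u` in `B` lies outside `A`, then `u` and a basis of `A` span `B`: `v + x u` is in `A`,
  -- and subtracting `x u` recovers `v`. Otherwise `B ⊆ A`. The search for `u` runs through the
  -- finitely many vectors.
  codim≤1⇒dim≤ : A ⊆ B → Codim≤1 A B → dim 𝔽 B ℕ.≤ suc (dim 𝔽 A)
  codim≤1⇒dim≤ {A = A} {B} A⊆B codim
    with Any.any? (λ u → member? B u ×-dec ¬? (member? A u)) (allVectors _)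
  ... | no ∄u = ℕ.m≤n⇒m≤1+n (dim-mono {A = B} {A} λ {v} v∈B → decidable-stable (member? A v) λ v∉A →
    ∄u (Any.map (λ v≋u → resp-≋ B v≋u v∈B , v∉A ∘ resp-≋ A (≋-sym v≋u)) (allVectors-complete _ v)))
  ... | yes ∃u with u , u∈B , u∉A ← Any.satisfied ∃u =
    dim-spanned {B = B} {b′ = u Vector.∷ vectors (basisOf A)} λ v v∈B →
      let x , w∈A = codim u∈B u∉A v∈B
          a , w≋  = spanning (basisOf A) _ w∈A
      in - x Vector.∷ a , λ j → trans (sym (recover (v j) x (u j))) (+-congˡ (w≋ j))

  -- If `v` were not a combination of `u` and a basis of `A`, then `v`, `u` and that basis would be
  -- `2 + dim 𝔽 A` independent vectors in `B`.
  dim≤⇒codim≤1 : A ⊆ B → dim 𝔽 B ℕ.≤ suc (dim 𝔽 A) → Codim≤1 A B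
  dim≤⇒codim≤1 {A = A} {B} A⊆B dim≤ {u} {v} u∈B u∉A v∈B
    with v ∈Span? (u Vector.∷ vectors (basisOf A))
  -- Minus the coefficient of `u` in `v`: what is left is a combination of the basis of `A`.
  ... | yes (a , v≋) = - a zero , resp-≋ A (≋-sym w≋)
          (lincomb-mem A _ (contained (basisOf A)) (Vector.tail a))
    where
    open SetoidReasoning setoid
    w≋ : (λ j → v j + - a zero * u j) ≋ lincomb 𝔽 (Vector.tail a) (vectors (basisOf A))
    w≋ j = let y = lincomb 𝔽 (Vector.tail a) (vectors (basisOf A)) j in begin
      v j + - a zero * u j                    ≈⟨ +-congʳ (trans (v≋ j) (+-comm _ _)) ⟩
      y + a zero * u j + - a zero * u j       ≈⟨ +-comm _ _ ⟩
      - a zero * u j + (y + a zero * u j)     ≈⟨ recover y (a zero) (u j) ⟩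
      y                                       ∎
  ... | no v∉ = contradiction
    (independent⇒≤dim B {b = v Vector.∷ (u Vector.∷ b)}
      (∷-independent v (u Vector.∷ b) v∉ (∷-independent u b (u∉A ∘ span⊆ A) (independent (basisOf A))))
      (λ { zero → v∈B ; (suc zero) → u∈B ; (suc (suc i)) → A⊆B (contained (basisOf A) i) }))
    (ℕ.≤⇒≯ dim≤)
    where
    b : Vector (Vector Carrier _) (dim 𝔽 A)
    b = vectors (basisOf A)

  -- A common subspace W of the larger spaces keeps the codimension at most 1,
  -- since the corrected vector v + x u stays in W.
  dim-∩-step : (W : Subspace 𝔽 n) → A ⊆ B → dim 𝔽 B ℕ.≤ suc (dim 𝔽 A) →
               dim 𝔽 (_∩_ 𝔽 B W) ℕ.≤ suc (dim 𝔽 (_∩_ 𝔽 A W))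
  dim-∩-step {A = A} {B} W A⊆B dim≤ =
    codim≤1⇒dim≤ {A = _∩_ 𝔽 A W} {_∩_ 𝔽 B W} (λ (v∈A , v∈W) → A⊆B v∈A , v∈W)
      λ {u} {v} (u∈B , u∈W) u∉A∩W (v∈B , v∈W) →
        let x , w∈A = dim≤⇒codim≤1 {A = A} {B} A⊆B dim≤ {u} {v} u∈B (λ u∈A → u∉A∩W (u∈A , u∈W)) v∈B
        in x , w∈A , +-mem W v∈W (*-mem W x u∈W)

  dim-∩-comm : (A B : Subspace 𝔽 n) → dim 𝔽 (_∩_ 𝔽 A B) ℕ.≤ dim 𝔽 (_∩_ 𝔽 B A)
  dim-∩-comm A B = dim-mono {A = _∩_ 𝔽 A B} {_∩_ 𝔽 B A} λ (v∈A , v∈B) → v∈B , v∈A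

  dim-∩-mono : A ⊆ B → A′ ⊆ B′ → dim 𝔽 (_∩_ 𝔽 A A′) ℕ.≤ dim 𝔽 (_∩_ 𝔽 B B′)
  dim-∩-mono {A = A} {B} {A′} {B′} A⊆B A′⊆B′ = dim-mono {A = _∩_ 𝔽 A A′} {_∩_ 𝔽 B B′}
    λ (v∈A , v∈A′) → A⊆B v∈A , A′⊆B′ v∈A′

  -- One factor is enlarged at a time, with the intersection of `A` and `B′` in between; the swaps
  -- bring the second factor to the front, where `dim-∩-step` acts.
  dim-∩-step₂ : A ⊆ B → A′ ⊆ B′ → dim 𝔽 B ℕ.≤ suc (dim 𝔽 A) → dim 𝔽 B′ ℕ.≤ suc (dim 𝔽 A′) →
                dim 𝔽 (_∩_ 𝔽 B B′) ℕ.≤ 2 ℕ.+ dim 𝔽 (_∩_ 𝔽 A A′)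
  dim-∩-step₂ {A = A} {B} {A′} {B′} A⊆B A′⊆B′ dim≤ dim′≤ = begin
    dim 𝔽 (_∩_ 𝔽 B B′)          ≤⟨ dim-∩-step {A = A} {B} B′ A⊆B dim≤ ⟩
    1 ℕ.+ dim 𝔽 (_∩_ 𝔽 A B′)    ≤⟨ s≤s (dim-∩-comm A B′) ⟩
    1 ℕ.+ dim 𝔽 (_∩_ 𝔽 B′ A)    ≤⟨ s≤s (dim-∩-step {A = A′} {B′} A A′⊆B′ dim′≤) ⟩
    2 ℕ.+ dim 𝔽 (_∩_ 𝔽 A′ A)    ≤⟨ s≤s (s≤s (dim-∩-comm A′ A)) ⟩
    2 ℕ.+ dim 𝔽 (_∩_ 𝔽 A A′)    ∎
    where open ℕ.≤-Reasoning

  -- Coordinate subspaces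

  coordinate : Subset n → Subspace 𝔽 n
  coordinate p = record
    -- The vectors supported on `p`; `Lift` only adjusts the universe level.
    { Member  = λ v → Lift c (∀ j → j ∉ p → v j ≈ 0#)
    ; member? = λ v → map′ lift lower (Fin.all? λ j → ¬? (j ∈? p) →-dec (v j ≟ 0#))
    ; resp-≋  = λ u≋v (lift u∈) → lift λ j j∉p → trans (sym (u≋v j)) (u∈ j j∉p)
    ; 0-mem   = lift λ _ _ → refl
    ; +-mem   = λ (lift u∈) (lift v∈) → lift λ j j∉p →
                  trans (+-cong (u∈ j j∉p) (v∈ j j∉p)) (+-identityˡ 0#)
    ; *-mem   = λ x (lift v∈) → lift λ j j∉p → trans (*-congˡ (v∈ j j∉p)) (zeroʳ x)
    }

  coordinate-mono : ∀ {p r : Subset n} → p Subset.⊆ r → coordinate p ⊆ coordinate r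
  coordinate-mono p⊆r (lift v∈) = lift λ j j∉r → v∈ j (j∉r ∘ p⊆r)

  private
    sum-zero : (a : Vector Carrier k) → sum (λ i → a i * 0#) ≈ 0#
    sum-zero {k} a = trans (sum-cong-≋ (λ i → zeroʳ (a i))) (sum-replicate-zero k)

  -- The unit vectors at the elements of `p`, listed by recursion on `p` so that their number is
  -- `∣ p ∣` by computation.
  coordinateBasis : (p : Subset n) → Basis 𝔽 (coordinate p) ∣ p ∣
  coordinateBasis [] = record
    { vectors     = λ ()
    ; contained   = λ ()
    ; independent = λ _ _ ()
    ; spanning    = λ _ _ → (λ ()) , λ ()
    }
  coordinateBasis (outside ∷ p) = record
    { vectors     = λ i → 0# Vector.∷ vectors b i
    ; contained   = λ i → lift λ
        { zero    _  → refl
        ; (suc j) j∉ → lower (contained b i) j (j∉ ∘ there) }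
    ; independent = λ a a≋ → independent b a (a≋ ∘ suc)
    ; spanning    = λ v (lift v∈) →
        let a , v≋ = spanning b (Vector.tail v) (lift λ j j∉ → v∈ (suc j) λ { (there j∈) → j∉ j∈ })
        in a , λ { zero    → trans (v∈ zero λ ()) (sym (sum-zero a))
                 ; (suc j) → v≋ j }
    }
    where
    b : Basis 𝔽 (coordinate p) ∣ p ∣
    b = coordinateBasis p
  coordinateBasis {n = suc n} (inside ∷ p) = record
    { vectors     = e₀ Vector.∷ λ i → 0# Vector.∷ vectors b i
    ; contained   = λ
        { zero    → lift λ { zero 0∉ → contradiction here 0∉ ; (suc _) _ → refl }
        ; (suc i) → lift λ
            { zero    _  → refl
            ; (suc j) j∉ → lower (contained b i) j (j∉ ∘ there) } }
    ; independent = λ a a≋ →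
        λ { zero    → trans (sym (at-zero a)) (a≋ zero)
          ; (suc i) → independent b (Vector.tail a) (λ j → trans (sym (at-suc a j)) (a≋ (suc j))) i }
    ; spanning    = λ v (lift v∈) →
        let a , v≋ = spanning b (Vector.tail v) (lift λ j j∉ → v∈ (suc j) λ { (there j∈) → j∉ j∈ })
        in v zero Vector.∷ a ,
           λ { zero    → sym (at-zero (v zero Vector.∷ a))
             ; (suc j) → trans (v≋ j) (sym (at-suc (v zero Vector.∷ a) j)) }
    }
    where
    b : Basis 𝔽 (coordinate p) ∣ p ∣
    b = coordinateBasis p

    e₀ : Vector Carrier (suc n)
    e₀ = 1# Vector.∷ λ _ → 0#

    at-zero : ∀ a → lincomb 𝔽 a (e₀ Vector.∷ λ i → 0# Vector.∷ vectors b i) zero ≈ a zero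
    at-zero a = trans (+-cong (*-identityʳ _) (sum-zero (Vector.tail a))) (+-identityʳ _)

    at-suc : ∀ a j → lincomb 𝔽 a (e₀ Vector.∷ λ i → 0# Vector.∷ vectors b i) (suc j) ≈
                     lincomb 𝔽 (Vector.tail a) (vectors b) j
    at-suc a j = trans (+-congʳ (zeroʳ _)) (+-identityˡ _)

  dim-coordinate : (p : Subset n) → dim 𝔽 (coordinate p) ≡ ∣ p ∣
  dim-coordinate p = dim-unique {B = coordinate p} (coordinateBasis p)

  dim-coordinate-∩ : (p r : Subset n) →
                     dim 𝔽 (_∩_ 𝔽 (coordinate p) (coordinate r)) ≡ ∣ p Subset.∩ r ∣
  dim-coordinate-∩ p r = ≡.trans
    (ℕ.≤-antisym
      (dim-mono {A = _∩_ 𝔽 (coordinate p) (coordinate r)} {coordinate (p Subset.∩ r)}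
        -- A nonzero entry at `j` forces `j` into both `p` and `r`; decidable equality in 𝔽 removes
        -- the double negation.
        λ {v} (lift v∈p , lift v∈r) → lift λ j j∉ → decidable-stable (v j ≟ 0#) λ vj≉0 →
          j∉ (Subset.x∈p∩q⁺ ( decidable-stable (j ∈? p) (vj≉0 ∘ v∈p j)
                            , decidable-stable (j ∈? r) (vj≉0 ∘ v∈r j))))
      (dim-mono {A = coordinate (p Subset.∩ r)} {_∩_ 𝔽 (coordinate p) (coordinate r)}
        λ v∈ → coordinate-mono (Subset.p∩q⊆p p r) v∈ , coordinate-mono (Subset.p∩q⊆q p r) v∈))
    (dim-coordinate (p Subset.∩ r))

open ≡ using (refl; sym; trans; cong; cong₂; module ≡-Reasoning)

module ℤ-Sum = CommutativeMonoidSum ℤ.+-0-commutativeMonoid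
module ℚ-Sum = CommutativeMonoidSum ℚ.+-0-commutativeMonoid

private
  variable
    m n : ℕ

-- Heights, components, words and area

stepOf-rise : ∀ s → StepOf (rise s) s
stepOf-rise U = up
stepOf-rise D = down
stepOf-rise H = flat

-- Junk outside {-1, 0, 1}: only the sign matters.
toStep : ℤ → Step
toStep (+ zero)  = H
toStep (+ suc _) = U
toStep -[1+ _ ]  = D

toStep-rise : ∀ s → toStep (rise s) ≡ s
toStep-rise U = refl
toStep-rise D = refl
toStep-rise H = refl

-- Defined on all integer vectors, so that the word depends on `δ` alone and not on the flags that
-- realize it.
wordOf : Vec ℤ m → Vec Step (suc m)
wordOf δ = tabulate λ i → toStep (component δ (suc (toℕ i)) ℤ.- component δ (toℕ i))

lookup-wordOf : (δ : Vec ℤ m) (i : Fin (suc m)) →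
                lookup (wordOf δ) i ≡ toStep (component δ (suc (toℕ i)) ℤ.- component δ (toℕ i))
lookup-wordOf δ = Vec.lookup∘tabulate λ i → toStep (component δ (suc (toℕ i)) ℤ.- component δ (toℕ i))

height-suc : (w : Vec Step n) (i : Fin n) →
             height w (suc i) ≡ height w (inject₁ i) ℤ.+ rise (lookup w i)
height-suc (s ∷ w) zero    = ℤ.+-comm (rise s) 0ℤ
height-suc (s ∷ w) (suc i) = trans (cong (λ x → rise s ℤ.+ x) (height-suc w i))
  (sym (ℤ.+-assoc (rise s) (height w (inject₁ i)) (rise (lookup w i))))

height-difference : (w : Vec Step n) (i : Fin n) →
                    height w (suc i) ℤ.- height w (inject₁ i) ≡ rise (lookup w i)
height-difference w i = trans (cong (ℤ._- height w (inject₁ i)) (height-suc w i))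
  (cancel (height w (inject₁ i)) (rise (lookup w i)))
  where
  cancel : ∀ x y → x ℤ.+ y ℤ.- x ≡ y
  cancel = ℤ-Solver.solve-∀

-- A sequence is determined by its first value and its increments. The main use takes for `g` the
-- components of a distance vector.
height-unique : (w : Vec Step n) (g : ℕ → ℤ) → g 0 ≡ 0ℤ →
                (∀ (i : Fin n) → g (suc (toℕ i)) ℤ.- g (toℕ i) ≡ rise (lookup w i)) →
                ∀ i → height w i ≡ g (toℕ i)
height-unique w g g₀≡0 g-step = <-weakInduction _ (sym g₀≡0) λ i height≡ → begin
  height w (suc i)                                   ≡⟨ height-suc w i ⟩
  height w (inject₁ i) ℤ.+ rise (lookup w i)         ≡⟨ cong₂ ℤ._+_ height≡ (sym (g-step i)) ⟩
  g (toℕ (inject₁ i)) ℤ.+ (g (suc (toℕ i)) ℤ.- g (toℕ i))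
    ≡⟨ cong (λ k → g k ℤ.+ (g (suc (toℕ i)) ℤ.- g (toℕ i))) (Fin.toℕ-inject₁ i) ⟩
  g (toℕ i) ℤ.+ (g (suc (toℕ i)) ℤ.- g (toℕ i))      ≡⟨ cancel (g (toℕ i)) (g (suc (toℕ i))) ⟩
  g (suc (toℕ i))                                    ∎
  where
  open ≡-Reasoning
  cancel : ∀ x y → x ℤ.+ (y ℤ.- x) ≡ y
  cancel = ℤ-Solver.solve-∀

component-last : (δ : Vec ℤ m) → component δ (suc m) ≡ 0ℤ
component-last {m} δ with m ℕ.<? m
... | yes m<m = contradiction m<m (ℕ.<-irrefl refl)
... | no _    = refl

component-lookup : (δ : Vec ℤ m) (i : Fin m) → component δ (suc (toℕ i)) ≡ lookup δ i
component-lookup {m} δ i with toℕ i ℕ.<? m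
... | yes i<m = cong (lookup δ) (Fin.fromℕ<-toℕ i i<m)
... | no i≮m  = contradiction (Fin.toℕ<n i) i≮m

component-unique : (δ : Vec ℤ m) (g : Fin (suc (suc m)) → ℤ) → g zero ≡ 0ℤ → g (fromℕ (suc m)) ≡ 0ℤ →
                   (∀ i → lookup δ i ≡ g (suc (inject₁ i))) → ∀ i → component δ (toℕ i) ≡ g i
component-unique δ g g₀≡0 gₙ≡0 δ≡g zero = sym g₀≡0
component-unique {m} δ g g₀≡0 gₙ≡0 δ≡g (suc i) with toℕ i ℕ.<? m
... | yes i<m = trans (δ≡g (fromℕ< i<m)) (cong (g ∘ suc)
  (Fin.toℕ-injective (trans (Fin.toℕ-inject₁ _) (Fin.toℕ-fromℕ< i<m))))
-- The default value of `component` is met only at `i = m`, the last index, where `g` vanishes too.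
... | no i≮m = sym (trans (cong (g ∘ suc) (Fin.toℕ-injective (trans
  (ℕ.≤-antisym (ℕ.s≤s⁻¹ (Fin.toℕ<n i)) (ℕ.≮⇒≥ i≮m)) (sym (Fin.toℕ-fromℕ m))))) gₙ≡0)

component-injective : {δ δ′ : Vec ℤ m} →
                      (∀ (i : Fin m) → component δ (suc (toℕ i)) ≡ component δ′ (suc (toℕ i))) → δ ≡ δ′
component-injective {δ = δ} {δ′} eq = trans (sym (Vec.tabulate∘lookup δ))
  (trans (Vec.tabulate-cong λ i → trans (sym (component-lookup δ i))
                                        (trans (eq i) (component-lookup δ′ i)))
         (Vec.tabulate∘lookup δ′))

wordOf-height : (δ : Vec ℤ m) (w : Vec Step (suc m)) →
                (∀ i → component δ (toℕ i) ≡ height w i) → wordOf δ ≡ w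
wordOf-height δ w δ≡height = trans (Vec.tabulate-cong λ i → begin
  toStep (component δ (suc (toℕ i)) ℤ.- component δ (toℕ i))
    ≡⟨ cong (λ k → toStep (component δ (suc (toℕ i)) ℤ.- component δ k)) (Fin.toℕ-inject₁ i) ⟨
  toStep (component δ (suc (toℕ i)) ℤ.- component δ (toℕ (inject₁ i)))
    ≡⟨ cong₂ (λ x y → toStep (x ℤ.- y)) (δ≡height (suc i)) (δ≡height (inject₁ i)) ⟩
  toStep (height w (suc i) ℤ.- height w (inject₁ i))
    ≡⟨ cong toStep (height-difference w i) ⟩
  toStep (rise (lookup w i))
    ≡⟨ toStep-rise (lookup w i) ⟩
  lookup w i ∎) (Vec.tabulate∘lookup w)
  where open ≡-Reasoning

-- `ℚ./` reduces to lowest terms, so the identity is checked on unnormalised fractions, by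
-- cross-multiplying with the denominators 4 and 2.
/2-+ : ∀ x y → (x ℚ./ 2) ℚ.+ (y ℚ./ 2) ≡ (x ℤ.+ y) ℚ./ 2
/2-+ x y = ℚ.toℚᵘ-injective (begin
  toℚᵘ ((x ℚ./ 2) ℚ.+ (y ℚ./ 2))                ≈⟨ ℚ.toℚᵘ-homo-+ (x ℚ./ 2) (y ℚ./ 2) ⟩
  toℚᵘ (x ℚ./ 2) ℚᵘ.+ toℚᵘ (y ℚ./ 2)            ≈⟨ ℚᵘ.+-cong (ℚ.toℚᵘ-fromℚᵘ (mkℚᵘ x 1)) (ℚ.toℚᵘ-fromℚᵘ (mkℚᵘ y 1)) ⟩
  mkℚᵘ x 1 ℚᵘ.+ mkℚᵘ y 1                        ≈⟨ *≡* (common-denominator x y) ⟩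
  mkℚᵘ (x ℤ.+ y) 1                              ≈⟨ ℚ.toℚᵘ-fromℚᵘ (mkℚᵘ (x ℤ.+ y) 1) ⟨
  toℚᵘ ((x ℤ.+ y) ℚ./ 2)                        ∎)
  where
  open ℚᵘ.≃-Reasoning
  common-denominator : ∀ x y → (x ℤ.* + 2 ℤ.+ y ℤ.* + 2) ℤ.* + 2 ≡ (x ℤ.+ y) ℤ.* + 4
  common-denominator = ℤ-Solver.solve-∀

double-/2 : ∀ x → (x ℤ.+ x) ℚ./ 2 ≡ x ℚ./ 1
double-/2 x = ℚ.fromℚᵘ-cong {mkℚᵘ (x ℤ.+ x) 1} {mkℚᵘ x 0} (*≡* (lemma x))
  where
  lemma : ∀ x → (x ℤ.+ x) ℤ.* + 1 ≡ x ℤ.* + 2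
  lemma = ℤ-Solver.solve-∀

/1-injective : ∀ {x y} → x ℚ./ 1 ≡ y ℚ./ 1 → x ≡ y
/1-injective {x} {y} eq with *≡* x*1≡y*1 ← ℚ.fromℚᵘ-injective {mkℚᵘ x 0} {mkℚᵘ y 0} eq =
  ℤ.*-cancelʳ-≡ x y 1ℤ x*1≡y*1

sum-/2 : (f : Fin n → ℤ) → ℚ-Sum.sum (λ i → f i ℚ./ 2) ≡ ℤ-Sum.sum f ℚ./ 2
sum-/2 {zero}  f = refl
sum-/2 {suc n} f = trans (cong (λ x → f zero ℚ./ 2 ℚ.+ x) (sum-/2 (f ∘ suc))) (/2-+ (f zero) (ℤ-Sum.sum (f ∘ suc)))

sum-lookup : (δ : Vec ℤ m) → ℤ-Sum.sum (lookup δ) ≡ sumℤ δ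
sum-lookup []      = refl
sum-lookup (x ∷ δ) = cong (λ y → x ℤ.+ y) (sum-lookup δ)

-- Both the left and the right sides of the trapezoids add up to the sum of
-- the inner heights, as the first and the last height vanish.
area-sum : (p : Motzkin (suc m)) (δ : Vec ℤ m) →
           (∀ i → height (Motzkin.word p) (suc (inject₁ i)) ≡ lookup δ i) → area p ≡ sumℤ δ ℚ./ 1
area-sum {m} p δ height≡ = trans (sum-/2 (λ i → h (inject₁ i) ℤ.+ h (suc i))) (trans (cong (ℚ._/ 2) (begin
  ℤ-Sum.sum (λ i → h (inject₁ i) ℤ.+ h (suc i))              ≡⟨ ℤ-Sum.∑-distrib-+ (h ∘ inject₁) (h ∘ suc) ⟩
  ℤ-Sum.sum (h ∘ inject₁) ℤ.+ ℤ-Sum.sum (h ∘ suc)            ≡⟨ cong₂ ℤ._+_ (trans (ℤ.+-identityˡ _) inner) right ⟩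
  sumℤ δ ℤ.+ sumℤ δ                                          ∎)) (double-/2 (sumℤ δ)))
  where
  open ≡-Reasoning
  h = height (Motzkin.word p)

  inner : ℤ-Sum.sum (λ i → h (suc (inject₁ i))) ≡ sumℤ δ
  inner = trans (ℤ-Sum.sum-cong-≗ height≡) (sum-lookup δ)

  right : ℤ-Sum.sum (h ∘ suc) ≡ sumℤ δ
  right = begin
    ℤ-Sum.sum (h ∘ suc)                                      ≡⟨ ℤ-Sum.sum-init-last (h ∘ suc) ⟩
    ℤ-Sum.sum (λ i → h (suc (inject₁ i))) ℤ.+ h (suc (fromℕ m))  ≡⟨ cong₂ ℤ._+_ inner (Motzkin.returns p) ⟩
    sumℤ δ ℤ.+ 0ℤ                                            ≡⟨ ℤ.+-identityʳ _ ⟩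
    sumℤ δ                                                   ∎

-- Here `a` and `b` are the dimensions of consecutive intersections. If `b = a + k`, the distance
-- changes by `1 - k`, and `k` is 0, 1 or 2.
step-of-increment : ∀ {a b} i → a ℕ.≤ b → b ℕ.≤ 2 ℕ.+ a →
                    ∃ λ s → (+ suc i ℤ.- + b) ℤ.- (+ i ℤ.- + a) ≡ rise s
step-of-increment {a} {b} i a≤b b≤2+a with ℕ.m≤n⇒∃[o]m+o≡n a≤b
... | k , refl = by-cases k (ℕ.+-cancelˡ-≤ a k 2 (ℕ.≤-trans b≤2+a (ℕ.≤-reflexive (ℕ.+-comm 2 a))))
  where
  difference : ∀ x y z → 1ℤ ℤ.+ x ℤ.- (y ℤ.+ z) ℤ.- (x ℤ.- y) ≡ 1ℤ ℤ.- z
  difference = ℤ-Solver.solve-∀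

  by-cases : ∀ k → k ℕ.≤ 2 → ∃ λ s → (+ suc i ℤ.- + (a ℕ.+ k)) ℤ.- (+ i ℤ.- + a) ≡ rise s
  by-cases 0 _ = U , difference (+ i) (+ a) (+ 0)
  by-cases 1 _ = H , difference (+ i) (+ a) (+ 1)
  by-cases 2 _ = D , difference (+ i) (+ a) (+ 2)
  by-cases (suc (suc (suc _))) (s≤s (s≤s ()))

-- The Motzkin path of a distance vector

module DistanceVectors {c ℓ₁ ℓ₂ q} (1<q : 1 ℕ.< q) (𝔽 : FiniteField c ℓ₁ ℓ₂ q) {m : ℕ} where

  open LinearAlgebra 1<q 𝔽
  open Flag

  -- The flag completed by the subspaces of dimension 0 and m + 1; the index is
  -- the dimension.
  complete : Flag 𝔽 (suc m) → ℕ → Subspace 𝔽 (suc m)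
  complete F zero = coordinate Subset.⊥
  complete F (suc i) with i ℕ.<? m
  ... | yes i<m = space F (fromℕ< i<m)
  ... | no _    = coordinate Subset.⊤

  dim-complete : ∀ F {i} → i ℕ.≤ suc m → dim 𝔽 (complete F i) ≡ i
  dim-complete F {zero} _ = trans (dim-coordinate {suc m} Subset.⊥) (Subset.∣⊥∣≡0 (suc m))
  dim-complete F {suc i} (s≤s i≤m) with i ℕ.<? m
  ... | yes i<m = trans (dims F (fromℕ< i<m)) (cong suc (Fin.toℕ-fromℕ< i<m))
  ... | no i≮m  = trans (dim-coordinate {suc m} Subset.⊤)
    (trans (Subset.∣⊤∣≡n (suc m)) (cong suc (ℕ.≤-antisym (ℕ.≮⇒≥ i≮m) i≤m)))

  complete-mono : ∀ F i → complete F i ⊆ complete F (suc i)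
  complete-mono F zero {v} (lift v∈) =
    Subspace.resp-≋ (complete F 1) (λ j → FiniteField.sym 𝔽 (v∈ j Subset.∉⊥)) (Subspace.0-mem (complete F 1))
  complete-mono F (suc i) with i ℕ.<? m | suc i ℕ.<? m
  ... | yes i<m | yes i+1<m = proj₁ (nested F (ℕ.≤-reflexive
    (trans (cong suc (Fin.toℕ-fromℕ< i<m)) (sym (Fin.toℕ-fromℕ< i+1<m)))))
  ... | yes _   | no _      = λ _ → lift λ j j∉⊤ → contradiction Subset.∈⊤ j∉⊤
  ... | no i≮m  | yes i+1<m = contradiction (ℕ.<-trans (ℕ.n<1+n i) i+1<m) i≮m
  -- From index `m + 1` on, `complete F` stays the whole space.
  ... | no _    | no _      = λ v∈ → v∈

  module _ (F F′ : Flag 𝔽 (suc m)) where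

    dim-common : ℕ → ℕ
    dim-common i = dim 𝔽 (_∩_ 𝔽 (complete F i) (complete F′ i))

    dim-common-≤ : ∀ {i} → i ℕ.≤ suc m → dim-common i ℕ.≤ i
    dim-common-≤ {i} i≤ = ℕ.≤-trans
      (dim-mono {A = _∩_ 𝔽 (complete F i) (complete F′ i)} {complete F i} proj₁)
      (ℕ.≤-reflexive (dim-complete F i≤))

    -- The completion turns the zeros at both ends into genuine distances: there the two completed
    -- flags agree.
    component-distance : ∀ {i} → i ℕ.≤ suc m →
                         component (distanceVector 𝔽 F F′) i ≡ + i ℤ.- + dim-common i
    component-distance {zero} _ = cong (λ d → 0ℤ ℤ.- + d) (sym (ℕ.n≤0⇒n≡0 (dim-common-≤ z≤n)))
    component-distance {suc i} (s≤s i≤m) with i ℕ.<? m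
    ... | yes i<m = trans (Vec.lookup∘tabulate _ (fromℕ< i<m))
      (cong (λ d → + d ℤ.- + dim 𝔽 (_∩_ 𝔽 (space F (fromℕ< i<m)) (space F′ (fromℕ< i<m))))
        (trans (dims F (fromℕ< i<m)) (cong suc (Fin.toℕ-fromℕ< i<m))))
    ... | no i≮m = sym (trans (cong (λ d → + suc i ℤ.- + d) (begin
        dim 𝔽 (_∩_ 𝔽 (coordinate ⊤) (coordinate ⊤))   ≡⟨ dim-coordinate-∩ ⊤ ⊤ ⟩
        ∣ ⊤ Subset.∩ ⊤ ∣                               ≡⟨ cong ∣_∣ (Subset.∩-idem ⊤) ⟩
        ∣ ⊤ ∣                                          ≡⟨ Subset.∣⊤∣≡n (suc m) ⟩
        suc m                                          ≡⟨ cong suc (ℕ.≤-antisym (ℕ.≮⇒≥ i≮m) i≤m) ⟩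
        suc i                                          ∎)) (ℤ.+-inverseʳ (+ suc i)))
      where
      open ≡-Reasoning
      ⊤ : Subset (suc m)
      ⊤ = Subset.⊤

    component-step : ∀ {i} → i ℕ.≤ m → let δ = distanceVector 𝔽 F F′ in
                     ∃ λ s → component δ (suc i) ℤ.- component δ i ≡ rise s
    component-step {i} i≤m =
      let s , eq = step-of-increment i
            (dim-∩-mono {A = complete F i} {complete F (suc i)} {complete F′ i} {complete F′ (suc i)}
              (complete-mono F i) (complete-mono F′ i))
            (dim-∩-step₂ {A = complete F i} {complete F (suc i)} {complete F′ i} {complete F′ (suc i)}
              (complete-mono F i) (complete-mono F′ i) (dim-suc F) (dim-suc F′))
      in s , trans (cong₂ ℤ._-_ (component-distance (s≤s i≤m)) (component-distance (ℕ.m≤n⇒m≤1+n i≤m))) eq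
      where
      dim-suc : ∀ F → dim 𝔽 (complete F (suc i)) ℕ.≤ suc (dim 𝔽 (complete F i))
      dim-suc F = ℕ.≤-reflexive (trans (dim-complete F (s≤s i≤m))
                                       (cong suc (sym (dim-complete F (ℕ.m≤n⇒m≤1+n i≤m)))))

    component-nonneg : ∀ {i} → i ℕ.≤ suc m → 0ℤ ℤ.≤ component (distanceVector 𝔽 F F′) i
    component-nonneg i≤ = ≡.subst (0ℤ ℤ.≤_) (sym (component-distance i≤))
      (ℤ.i≤j⇒0≤j-i (+≤+ (dim-common-≤ i≤)))

    -- By `component-step` the difference is `rise s` for some letter `s`, so `toStep` recovers `s`
    -- and never meets its junk values.
    rise-lookup-wordOf : ∀ i → let δ = distanceVector 𝔽 F F′ in
      component δ (suc (toℕ i)) ℤ.- component δ (toℕ i) ≡ rise (lookup (wordOf δ) i)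
    rise-lookup-wordOf i with s , eq ← component-step (ℕ.s≤s⁻¹ (Fin.toℕ<n i)) =
      trans eq (cong rise (sym (begin
        lookup (wordOf δ) i                                          ≡⟨ lookup-wordOf δ i ⟩
        toStep (component δ (suc (toℕ i)) ℤ.- component δ (toℕ i))   ≡⟨ cong toStep eq ⟩
        toStep (rise s)                                              ≡⟨ toStep-rise s ⟩
        s                                                            ∎)))
      where
      open ≡-Reasoning
      δ : Vec ℤ m
      δ = distanceVector 𝔽 F F′

    height-wordOf : ∀ i → let δ = distanceVector 𝔽 F F′ in height (wordOf δ) i ≡ component δ (toℕ i)
    height-wordOf = height-unique _ (component (distanceVector 𝔽 F F′)) refl rise-lookup-wordOf

  height-Ψ : (v : 𝒟 𝔽 (suc m)) → ∀ i → height (wordOf (proj₁ v)) i ≡ component (proj₁ v) (toℕ i)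
  height-Ψ (_ , F , F′ , refl) = height-wordOf F F′

  -- The equation `δ≡` is transported along, not matched on, so that the word of `Ψ v` reduces to
  -- `wordOf δ` for every `v`.
  Ψ : 𝒟 𝔽 (suc m) → Motzkin (suc m)
  Ψ v@(δ , F , F′ , δ≡) = record
    { word    = wordOf δ
    ; nonneg  = λ i → ≡.subst (0ℤ ℤ.≤_)
        (trans (cong (λ δ → component δ (toℕ i)) δ≡) (sym (height-Ψ v i)))
        (component-nonneg F F′ (ℕ.s≤s⁻¹ (Fin.toℕ<n i)))
    ; returns = trans (height-Ψ v (fromℕ (suc m)))
        (trans (cong (component δ ∘ suc) (Fin.toℕ-fromℕ m)) (component-last δ))
    }

  isΨ : IsΨ 𝔽 Ψ
  isΨ (_ , F , F′ , refl) i =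
    ≡.subst (λ x → StepOf x (lookup (wordOf (distanceVector 𝔽 F F′)) i))
            (sym (rise-lookup-wordOf F F′ i)) (stepOf-rise _)

  abstract
    Ψ-areaIsSum : AreaIsSum 𝔽 Ψ
    Ψ-areaIsSum v@(δ , _) = area-sum (Ψ v) δ λ i → trans (height-Ψ v (suc (inject₁ i)))
      (trans (cong (component δ ∘ suc) (Fin.toℕ-inject₁ i)) (component-lookup δ i))

  -- The word determines the heights, and these are the components.
  wordOf-injective : (v v′ : 𝒟 𝔽 (suc m)) → wordOf (proj₁ v) ≡ wordOf (proj₁ v′) → proj₁ v ≡ proj₁ v′
  wordOf-injective v@(δ , _) v′@(δ′ , _) eq = component-injective λ i → begin
    component δ (suc (toℕ i))                ≡⟨ cong (component δ ∘ suc) (Fin.toℕ-inject₁ i) ⟨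
    component δ (toℕ (suc (inject₁ i)))      ≡⟨ height-Ψ v (suc (inject₁ i)) ⟨
    height (wordOf δ) (suc (inject₁ i))      ≡⟨ cong (λ w → height w (suc (inject₁ i))) eq ⟩
    height (wordOf δ′) (suc (inject₁ i))     ≡⟨ height-Ψ v′ (suc (inject₁ i)) ⟩
    component δ′ (toℕ (suc (inject₁ i)))     ≡⟨ cong (component δ′ ∘ suc) (Fin.toℕ-inject₁ i) ⟩
    component δ′ (suc (toℕ i))               ∎
    where open ≡-Reasoning

-- Realizing a path by two chains of subsets

private
  variable
    a b c d h : ℕ
    p p′ r r′ : Subset n
    w : Vec Step m

-- A final segment of a Motzkin path, from height `h` down to 0. Natural numbers as heights build in
-- nonnegativity.
data Path : ℕ → Vec Step m → Set where
  end  : Path 0 []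
  up   : Path (suc h) w → Path h (U ∷ w)
  flat : Path h w → Path h (H ∷ w)
  down : Path h w → Path (suc h) (D ∷ w)

-- Each letter lowers the height by at most 1.
path-height≤length : {w : Vec Step m} → Path h w → h ℕ.≤ m
path-height≤length end         = z≤n
path-height≤length (up path)   = ℕ.m≤n⇒m≤1+n (ℕ.<⇒≤ (path-height≤length path))
path-height≤length (flat path) = ℕ.m≤n⇒m≤1+n (path-height≤length path)
path-height≤length (down path) = s≤s (path-height≤length path)

mkPath : ∀ h (w : Vec Step m) → (∀ i → 0ℤ ℤ.≤ + h ℤ.+ height w i) →
         + h ℤ.+ height w (fromℕ m) ≡ 0ℤ → Path h w
mkPath zero    []      _      _       = end
mkPath h       (s ∷ w) nonneg returns = by-step h s (nonneg (suc zero)) λ h′ eq → mkPath h′ w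
  (λ i → ≡.subst (0ℤ ℤ.≤_) (sym (shift h′ eq i)) (nonneg (suc i)))
  (trans (shift h′ eq (fromℕ _)) returns)
  where
  shift : ∀ h′ → + h′ ≡ + h ℤ.+ rise s → ∀ i → + h′ ℤ.+ height w i ≡ + h ℤ.+ height (s ∷ w) (suc i)
  shift h′ eq i = trans (cong (λ x → x ℤ.+ height w i) eq) (ℤ.+-assoc (+ h) (rise s) (height w i))

  -- The hypothesis concerns the height after the first letter, its `0ℤ` being `height w zero`. At
  -- height 0 it rules out `D`.
  by-step : ∀ h s → 0ℤ ℤ.≤ + h ℤ.+ (rise s ℤ.+ 0ℤ) →
            (∀ h′ → + h′ ≡ + h ℤ.+ rise s → Path h′ w) → Path h (s ∷ w)
  by-step h       U _  path = up (path (suc h) (cong +_ (ℕ.+-comm 1 h)))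
  by-step h       H _  path = flat (path h (sym (ℤ.+-identityʳ (+ h))))
  by-step (suc h) D _  path = down (path h refl)
  by-step zero    D () path

motzkin⇒path : (p : Motzkin m) → Path 0 (Motzkin.word p)
motzkin⇒path p = mkPath 0 word (λ i → ≡.subst (0ℤ ℤ.≤_) (sym (ℤ.+-identityˡ _)) (nonneg i))
                        (trans (ℤ.+-identityˡ _) returns)
  where open Motzkin p

-- Overlap p r a b c d: of the coordinates, a lie in neither subset, b only in
-- p, c only in r, and d in both.
data Overlap : Subset n → Subset n → ℕ → ℕ → ℕ → ℕ → Set where
  []    : Overlap [] [] 0 0 0 0
  none  : Overlap p r a b c d → Overlap (outside ∷ p) (outside ∷ r) (suc a) b c d
  left  : Overlap p r a b c d → Overlap (inside  ∷ p) (outside ∷ r) a (suc b) c d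
  right : Overlap p r a b c d → Overlap (outside ∷ p) (inside  ∷ r) a b (suc c) d
  both  : Overlap p r a b c d → Overlap (inside  ∷ p) (inside  ∷ r) a b c (suc d)

overlap-swap : Overlap p r a b c d → Overlap r p a c b d
overlap-swap []        = []
overlap-swap (none o)  = none (overlap-swap o)
overlap-swap (left o)  = right (overlap-swap o)
overlap-swap (right o) = left (overlap-swap o)
overlap-swap (both o)  = both (overlap-swap o)

overlap-⊥ : ∀ n → Overlap {n} Subset.⊥ Subset.⊥ n 0 0 0
overlap-⊥ zero    = []
overlap-⊥ (suc n) = none (overlap-⊥ n)

∣left∣ : Overlap p r a b c d → ∣ p ∣ ≡ b ℕ.+ d
∣left∣ []        = refl
∣left∣ (none o)  = ∣left∣ o
∣left∣ (left o)  = cong suc (∣left∣ o)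
∣left∣ (right o) = ∣left∣ o
∣left∣ (both o)  = trans (cong suc (∣left∣ o)) (sym (ℕ.+-suc _ _))

∣both∣ : Overlap p r a b c d → ∣ p Subset.∩ r ∣ ≡ d
∣both∣ []        = refl
∣both∣ (none o)  = ∣both∣ o
∣both∣ (left o)  = ∣both∣ o
∣both∣ (right o) = ∣both∣ o
∣both∣ (both o)  = cong suc (∣both∣ o)

-- Adds to `p` the first coordinate lying in neither subset; the index `suc a` guarantees that there
-- is one.
none→left : Overlap p r (suc a) b c d → ∃ λ p′ → p Subset.⊆ p′ × Overlap p′ r a (suc b) c d
none→left (none o)  = _ , Subset.out⊆ Subset.⊆-refl , left o
none→left (left o)  = let _ , p⊆p′ , o′ = none→left o in _ , Subset.s⊆s p⊆p′ , left o′
none→left (right o) = let _ , p⊆p′ , o′ = none→left o in _ , Subset.s⊆s p⊆p′ , right o′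
none→left (both o)  = let _ , p⊆p′ , o′ = none→left o in _ , Subset.s⊆s p⊆p′ , both o′

right→both : Overlap p r a b (suc c) d → ∃ λ p′ → p Subset.⊆ p′ × Overlap p′ r a b c (suc d)
right→both (right o) = _ , Subset.out⊆ Subset.⊆-refl , both o
right→both (none o)  = let _ , p⊆p′ , o′ = right→both o in _ , Subset.s⊆s p⊆p′ , none o′
right→both (left o)  = let _ , p⊆p′ , o′ = right→both o in _ , Subset.s⊆s p⊆p′ , left o′
right→both (both o)  = let _ , p⊆p′ , o′ = right→both o in _ , Subset.s⊆s p⊆p′ , both o′

none→right : Overlap p r (suc a) b c d → ∃ λ r′ → r Subset.⊆ r′ × Overlap p r′ a b (suc c) d
none→right o = let _ , r⊆r′ , o′ = none→left (overlap-swap o) in _ , r⊆r′ , overlap-swap o′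

left→both : Overlap p r a (suc b) c d → ∃ λ r′ → r Subset.⊆ r′ × Overlap p r′ a b c (suc d)
left→both o = let _ , r⊆r′ , o′ = right→both (overlap-swap o) in _ , r⊆r′ , overlap-swap o′

-- Chains grow at the front, as the word is read. Hence sizes are counted from `∣ p ∣`, and `start`
-- lets `cons` prove `mono` for a new first subset.
record Chain (p : Subset n) (m : ℕ) : Set where
  field
    subset : Fin (suc m) → Subset n
    start  : ∀ i → p Subset.⊆ subset i
    mono   : ∀ {i j} → i Fin.≤ j → subset i Subset.⊆ subset j
    size   : ∀ i → ∣ subset i ∣ ≡ ∣ p ∣ ℕ.+ toℕ i

open Chain

constant : (p : Subset n) → Chain p 0
constant p = record
  { subset = λ _ → p
  ; start  = λ _ → Subset.⊆-refl
  ; mono   = λ _ → Subset.⊆-refl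
  ; size   = λ { zero → sym (ℕ.+-identityʳ ∣ p ∣) }
  }

cons : p Subset.⊆ p′ → ∣ p′ ∣ ≡ suc ∣ p ∣ → Chain p′ m → Chain p (suc m)
cons {p = p} p⊆p′ ∣p′∣≡ P = record
  { subset = λ { zero → p ; (suc i) → subset P i }
  ; start  = λ { zero → Subset.⊆-refl ; (suc i) → Subset.⊆-trans p⊆p′ (start P i) }
  ; mono   = λ { {zero}  {zero}  _         → Subset.⊆-refl
               ; {zero}  {suc j} _         → Subset.⊆-trans p⊆p′ (start P j)
               ; {suc i} {suc j} (s≤s i≤j) → mono P i≤j }
  ; size   = λ { zero    → sym (ℕ.+-identityʳ ∣ p ∣)
               ; (suc i) → trans (size P i) (trans (cong (ℕ._+ toℕ i) ∣p′∣≡) (sym (ℕ.+-suc ∣ p ∣ (toℕ i)))) }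
  }

-- The word is a final segment of the path, starting at height `h`. The distances are counted on
-- subsets and become dimensions by `dim-coordinate` and `dim-coordinate-∩`.
record Realization (h : ℕ) (w : Vec Step m) (p r : Subset n) : Set where
  field
    first     : Chain p m
    second    : Chain r m
    distances : ∀ i → + ∣ subset first i ∣ ℤ.- + ∣ subset first i Subset.∩ subset second i ∣ ≡
                      + h ℤ.+ height w i

-- The distance counts the coordinates that only `p` has. The summand `0ℤ` matches `height w zero`.
distance-overlap : Overlap p r a b c d → + ∣ p ∣ ℤ.- + ∣ p Subset.∩ r ∣ ≡ + b ℤ.+ 0ℤ
distance-overlap {b = b} {d = d} o =
  trans (cong₂ (λ x y → + x ℤ.- + y) (∣left∣ o) (∣both∣ o)) (cancel (+ b) (+ d))
  where
  cancel : ∀ x y → x ℤ.+ y ℤ.- y ≡ x ℤ.+ 0ℤ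
  cancel = ℤ-Solver.solve-∀

-- Each subset has `h` coordinates of its own and `d` shared ones, so a single equation makes both
-- sizes grow by one; the second chain uses the swapped overlaps.
step : ∀ {s} {h′ a′ d′} {w : Vec Step m} → Overlap p r a h h d → Overlap p′ r′ a′ h′ h′ d′ →
       p Subset.⊆ p′ → r Subset.⊆ r′ →
       + h′ ≡ + h ℤ.+ rise s → h′ ℕ.+ d′ ≡ suc (h ℕ.+ d) →
       Realization h′ w p′ r′ → Realization h (s ∷ w) p r
step {h = h} {s = s} {w = w} o o′ p⊆p′ r⊆r′ h′≡ size′≡ R = record
  { first     = cons p⊆p′ (grows o o′) first
  ; second    = cons r⊆r′ (grows (overlap-swap o) (overlap-swap o′)) second
  ; distances = λ
      { zero    → distance-overlap o
      ; (suc i) → trans (distances i) (trans (cong (λ x → x ℤ.+ height w i) h′≡)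
                                             (ℤ.+-assoc (+ h) (rise s) (height w i))) }
  }
  where
  open Realization R
  grows : ∀ {p r p′ r′} → Overlap {n} p r _ _ _ _ → Overlap {n} p′ r′ _ _ _ _ → ∣ p′ ∣ ≡ suc ∣ p ∣
  grows o o′ = trans (∣left∣ o′) (trans size′≡ (cong suc (sym (∣left∣ o))))

-- A rise needs two unused coordinates, a level step one: a path at height h
-- cannot return in fewer than h steps, so enough of them are left.
realize : {w : Vec Step m} → Path h w → Overlap p r a h h d → a ℕ.+ h ≡ m → Realization h w p r
realize {p = p} {r} end o _ = record
  { first     = constant p
  ; second    = constant r
  ; distances = λ { zero → distance-overlap o }
  }
realize {a = zero} (up path) o refl = contradiction (ℕ.<⇒≤ (path-height≤length path)) ℕ.1+n≰n
realize {a = suc zero} (up path) o refl = contradiction (path-height≤length path) ℕ.1+n≰n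
realize {h = h} {a = suc (suc a)} (up path) o refl =
  let _ , p⊆p′ , o₁ = none→left o
      _ , r⊆r′ , o₂ = none→right o₁
  in step o o₂ p⊆p′ r⊆r′ (cong +_ (ℕ.+-comm 1 h)) refl (realize path o₂ (ℕ.+-suc a h))
realize {a = zero} (flat path) o refl = contradiction (path-height≤length path) ℕ.1+n≰n
realize {h = h} {a = suc a} (flat path) o refl =
  let _ , p⊆p′ , o₁ = none→left o
      _ , r⊆r′ , o₂ = left→both o₁
  in step o o₂ p⊆p′ r⊆r′ (sym (ℤ.+-identityʳ (+ h))) (ℕ.+-suc h _) (realize path o₂ refl)
realize {h = suc h} {a = a} (down path) o eq =
  let _ , p⊆p′ , o₁ = right→both o
      _ , r⊆r′ , o₂ = left→both o₁
  in step o o₂ p⊆p′ r⊆r′ refl (trans (ℕ.+-suc h _) (cong suc (ℕ.+-suc h _)))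
       (realize path o₂ (ℕ.suc-injective (trans (sym (ℕ.+-suc a h)) eq)))

abstract
  IsPrimePower⇒1< : ∀ {q} → IsPrimePower q → 1 ℕ.< q
  IsPrimePower⇒1< (p , k , p-prime , 1≤k , refl) =
    -- Compares `p ^ 0` with `p ^ k`; `1 ≤ k` is `0 < k`.
    ℕ.^-monoʳ-< p (ℕ.nonTrivial⇒n>1 p ⦃ prime⇒nonTrivial p-prime ⦄) 1≤k

-- Flags of coordinate subspaces

module CoordinateFlags {c ℓ₁ ℓ₂ q} (1<q : 1 ℕ.< q) (𝔽 : FiniteField c ℓ₁ ℓ₂ q) {m : ℕ} where

  open LinearAlgebra 1<q 𝔽

  -- The subsets of the chain have sizes 0 to `m + 1`; the indices `suc (inject₁ i)` leave out the
  -- empty and the full one.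
  chain⇒flag : Chain (Subset.⊥ {suc m}) (suc m) → Flag 𝔽 (suc m)
  chain⇒flag P = record
    { space  = space
    ; nested = λ {i} {j} i<j →
          coordinate-mono (mono P (s≤s (≡.subst₂ ℕ._≤_
            (sym (Fin.toℕ-inject₁ i)) (sym (Fin.toℕ-inject₁ j)) (ℕ.<⇒≤ i<j))))
        -- The reverse inclusion would make the dimension `suc (toℕ j)` at most `suc (toℕ i)`.
        , λ space-j⊆space-i → ℕ.<⇒≱ (s≤s i<j)
            (≡.subst₂ ℕ._≤_ (dims j) (dims i) (dim-mono {A = space j} {space i} space-j⊆space-i))
    ; dims   = dims
    }
    where
    space : Fin m → Subspace 𝔽 (suc m)
    space i = coordinate (subset P (suc (inject₁ i)))

    dims : ∀ i → dim 𝔽 (space i) ≡ suc (toℕ i)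
    dims i = begin
      dim 𝔽 (space i)                                ≡⟨ dim-coordinate (subset P (suc (inject₁ i))) ⟩
      ∣ subset P (suc (inject₁ i)) ∣                 ≡⟨ size P (suc (inject₁ i)) ⟩
      ∣ Subset.⊥ {suc m} ∣ ℕ.+ suc (toℕ (inject₁ i)) ≡⟨ cong₂ ℕ._+_ (Subset.∣⊥∣≡0 (suc m)) (cong suc (Fin.toℕ-inject₁ i)) ⟩
      suc (toℕ i)                                    ∎
      where open ≡-Reasoning

  realizing-flags : (p : Motzkin (suc m)) → ∃₂ λ F F′ →
    ∀ i → lookup (distanceVector 𝔽 {suc m} F F′) i ≡ height (Motzkin.word p) (suc (inject₁ i))
  realizing-flags p = chain⇒flag first , chain⇒flag second , λ i →
    let P = subset first (suc (inject₁ i)) ; R = subset second (suc (inject₁ i)) in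
    trans (Vec.lookup∘tabulate
            (λ i → injectionDistance 𝔽 (coordinate (subset first (suc (inject₁ i))))
                                       (coordinate (subset second (suc (inject₁ i))))) i)
    (trans (cong₂ (λ x y → + x ℤ.- + y) (dim-coordinate P) (dim-coordinate-∩ P R))
    (trans (distances (suc (inject₁ i))) (ℤ.+-identityˡ _)))
    where
    open Realization (realize (motzkin⇒path p) (overlap-⊥ (suc m)) (ℕ.+-identityʳ (suc m)))

-- The bijection for a fixed flag distance

module _ {c ℓ₁ ℓ₂ q} (1<q : 1 ℕ.< q) (𝔽 : FiniteField c ℓ₁ ℓ₂ q) {m : ℕ} where

  open DistanceVectors 1<q 𝔽 {m}
  open CoordinateFlags 1<q 𝔽 {m}

  restrict-Ψ-isBijection : ∀ d → IsBijection (_≈𝒟_ 𝔽) (_≈𝓜_ {d}) (restrict 𝔽 Ψ Ψ-areaIsSum d)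
  restrict-Ψ-isBijection d = record
    { isInjection = record
        { isCongruent = record
            { cong           = cong wordOf
            ; isEquivalence₁ = On.isEquivalence proj₁ ≡.isEquivalence
            ; isEquivalence₂ = On.isEquivalence (Motzkin.word ∘ proj₁) ≡.isEquivalence
            }
        ; injective = λ {(δ , F , F′ , δ≡ , _)} {(δ′ , G , G′ , δ′≡ , _)} →
            wordOf-injective (δ , F , F′ , δ≡) (δ′ , G , G′ , δ′≡)
        }
    ; surjective = surjective
    }
    where
    surjective : ∀ y → ∃ λ x → ∀ {z} → proj₁ z ≡ proj₁ x →
                 Motzkin.word (proj₁ (restrict 𝔽 Ψ Ψ-areaIsSum d z)) ≡ Motzkin.word (proj₁ y)
    surjective (p , area≡d) with F , F′ , distance≡height ← realizing-flags p =
      -- The area of `p` is both the sum of `δ` and `d`, as rationals; `/1-injective` brings the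
      -- equation back to the integers.
      (δ , F , F′ , refl , /1-injective (trans (sym (area-sum p δ (sym ∘ distance≡height))) area≡d)) ,
      -- Other flags may underlie `z`, but its word depends only on the vector.
      λ z≡δ → trans (cong wordOf z≡δ) (wordOf-height δ word
        (component-unique δ (height word) refl returns distance≡height))
      where
      open Motzkin p
      δ : Vec ℤ m
      δ = distanceVector 𝔽 F F′

open import Data.Nat.Base using (_*_; _≤_; _/_)

theorem4p14 : ∀ {c ℓ₁ ℓ₂} (q : ℕ) → IsPrimePower q → (𝔽 : FiniteField c ℓ₁ ℓ₂ q) →
    (n : ℕ) → 2 ≤ n →
    Σ[ Ψ ∈ (𝒟 𝔽 n → Motzkin n) ] IsΨ 𝔽 Ψ ×
    (Σ[ areaIsSum ∈ AreaIsSum 𝔽 Ψ ]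
    (∀ d → d ≤ n * n / 4 → IsBijection (_≈𝒟_ 𝔽) (_≈𝓜_ {d}) (restrict 𝔽 Ψ areaIsSum d)))
-- With `n` written as `suc m`, `n ∸ 1` computes to `m`.
theorem4p14 q q-primePower 𝔽 (suc m) _ =
  Ψ , isΨ , Ψ-areaIsSum , λ d _ → restrict-Ψ-isBijection 1<q 𝔽 d
  where
  1<q : 1 ℕ.< q
  1<q = IsPrimePower⇒1< q-primePower
  open DistanceVectors 1<q 𝔽 {m}
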